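{- Let $n\ge 1$ and let $R=(r_1,\dots,r_n)$ and $S=(s_1,\dots,s_n)$ be vectors of nonnegative integers, all of whose components are at most $n$, with $\sum_i r_i=\sum_j s_j$. Then $\mathcal{A}^{+1}(R,S)\neq\emptyset$ if and only if $S=R^r$ and $R^r\preceq R^*$.
   Context: $R^r=(r_n,\dots,r_2,r_1)$ is the reversal of $R$. $\mathcal{A}^{+1}(R,S)$ is the set of $n\times n$ matrices $A$ with entries in $\{0,1\}$, with $i$th row sum $r_i$ and $j$th column sum $s_j$ for all $i,j$, that are invariant under the reflection $r_{+1}$ in the line of slope $+1$, i.e. $a_{i,j}=a_{n+1-j,\,n+1-i}$ for all $i,j$. For a nonnegative integer vector $R$, $R^*$ denotes the conjugate of (the weakly decreasing rearrangement of) $R$ viewed as an integer partition: its $k$th component is the number of $i$ with $r_i\ge k$. For nonnegative integer vectors $U,V$, $V\preceq U$ ($V$ is majorized by $U$) means that, after rearranging both in weakly decreasing order (and padding with zeros to a common length), $u_1+\dots+u_\ell\ge v_1+\dots+v_\ell$ for all $\ell$, and the total sums of $U$ and $V$ are equal. -}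

module Defs where

open import Algebra.Properties.CommutativeMonoid.Sum as MonoidSum using ()
open import Data.Fin using (opposite)
open import Data.List using (List; map; length; filter; upTo; take)
open import Data.List.Extrema.Nat using (max)
open import Data.List.Sort as Sort using ()
open import Data.Nat using (ℕ; suc; _≤_; _≤?_)
open import Data.Nat.ListAction as ListAction using ()
open import Data.Nat.Properties using (+-0-commutativeMonoid; ≤-decTotalOrder)
open import Data.Product using (_×_)
open import Data.Sum using (_⊎_)
open import Data.Vec.Functional using (Vector; transpose)
open import Relation.Binary.PropositionalEquality using (_≡_)
open import Relation.Binary.Properties.DecTotalOrder ≤-decTotalOrder using (≥-decTotalOrder)

open MonoidSum +-0-commutativeMonoid public using (sum)

Matrix : ℕ → Set
Matrix n = Vector (Vector ℕ n) n

-- On Fin n, numbered from 0, `opposite` is the map i ↦ n + 1 - i on 1, …, n.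
record 𝒜⁺¹ {n : ℕ} (R S : Vector ℕ n) (A : Matrix n) : Set where
  field
    entries   : ∀ i j → A i j ≡ 0 ⊎ A i j ≡ 1
    rowSums   : ∀ i → sum (A i) ≡ R i
    colSums   : ∀ j → sum (transpose A j) ≡ S j
    invariant : ∀ i j → A i j ≡ A (opposite j) (opposite i)

-- The component at 0-based index k is the (k + 1)st, so it counts the parts
-- that are at least k + 1.  All components beyond the largest part vanish.
conjugate : List ℕ → List ℕ
conjugate xs = map (λ k → length (filter (suc k ≤?_) xs)) (upTo (max 0 xs))

sort↓ : List ℕ → List ℕ
sort↓ = Sort.sort ≥-decTotalOrder

infix 4 _≼_

-- `take ℓ` returns the whole list once ℓ exceeds its length, which has the
-- effect of padding the shorter list with zeros.
_≼_ : List ℕ → List ℕ → Set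
V ≼ U = (∀ ℓ → ListAction.sum (take ℓ (sort↓ V)) ≤ ListAction.sum (take ℓ (sort↓ U)))
      × ListAction.sum V ≡ ListAction.sum U

{-# OPTIONS --safe #-}

-- The reflection forces the column sums to be the reversed row sums, and
-- reversing the order of the columns turns a matrix invariant under it into a
-- symmetric one.  So the question is which R are the row sums of a symmetric
-- (0,1)-matrix with loops allowed.  Counting the ones in a set of rows shows
-- that majorization by the conjugate is necessary.  For sufficiency we use
-- that it implies the condition
--   R(K) + R(L) ≤ |K||L| + R(1, …, n)   for all sets K, L of indices,
-- which survives a Havel–Hakimi step: join an index m with R m maximal to the
-- R m indices of largest row sum, m itself included, and then discard m.
-- In the residual condition only threshold sets K and L matter, and these are
-- nested with the set of neighbours of m.

module Submission where

open import Defs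
open import Algebra.Properties.CommutativeMonoid.Sum as MonoidSum using ()
open import Algebra.Properties.CommutativeSemigroup as CommutativeSemigroup using ()
open import Algebra.Properties.Semiring.Sum as SemiringSum using ()
open import Data.Bool using (Bool; true; false; if_then_else_; _∨_)
open import Data.Bool.Properties using (¬-not) renaming (_≟_ to _≟ᵇ_)
open import Data.Fin using (Fin; zero; suc; opposite)
open import Data.Fin.Permutation as Perm using ()
open import Data.Fin.Properties using (_≟_; any?; opposite-involutive)
open import Data.List using (List; []; _∷_; map; length; filter; applyUpTo; take)
open import Data.List.Extrema.Nat using (max; xs≤max)
open import Data.List.Properties using (map-upTo; map-id; map-id-local)
open import Data.List.Relation.Binary.Permutation.Propositional as ↭ using (_↭_; ↭-sym)
open import Data.List.Relation.Unary.All as All using (All; []; _∷_)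
open import Data.List.Relation.Unary.Linked as Linked using (Linked; []; [-]; _∷_)
open import Data.List.Relation.Unary.Linked.Properties using (applyUpTo⁺₂)
open import Data.List.Sort as Sort using ()
open import Data.Nat using (ℕ; zero; suc; _+_; _*_; _∸_; _⊓_; _≤_; _<_; _≥_; z≤n; s≤s; _≤?_; _<?_)
open import Data.Nat.ListAction as ListAction using ()
open import Data.Nat.Properties hiding (_≟_; _≤?_; _<?_)
open import Data.Nat.Tactic.RingSolver using (solve-∀)
open import Data.Product using (_×_; _,_; proj₂; ∃)
open import Data.Sum using (_⊎_; inj₁; inj₂)
open import Data.Vec.Functional using (Vector; reverse; toList; transpose)
open import Function using (_∘_; const)
open import Function.Bundles using (_⇔_; mk⇔)
open import Relation.Binary.Properties.DecTotalOrder ≤-decTotalOrder using (≥-decTotalOrder)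
open import Relation.Binary.PropositionalEquality using (_≡_; _≢_; _≗_; refl; sym; trans; cong; cong₂; subst; module ≡-Reasoning)
open import Relation.Nullary using (¬_; Dec; yes; no; does; contradiction)
open import Relation.Nullary.Decidable using (¬?; _×-dec_; dec-true; dec-false)
open import Relation.Unary using (Satisfiable)

open MonoidSum +-0-commutativeMonoid using (sum-cong-≗; ∑-distrib-+; ∑-comm; sum-permute; sum-replicate-zero)
open CommutativeSemigroup +-commutativeSemigroup using (interchange; x∙yz≈y∙xz)
open SemiringSum +-*-semiring using (*-distribˡ-sum)

private
  variable
    n : ℕ

-- Sums over all indices and over subsets of indices.

sum-mono : {f g : Vector ℕ n} → (∀ i → f i ≤ g i) → sum f ≤ sum g
sum-mono {zero}  f≤g = z≤n
sum-mono {suc n} f≤g = +-mono-≤ (f≤g zero) (sum-mono (f≤g ∘ suc))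

-- Two sums are compared at once because in the exchange arguments below the pointwise inequality
-- may hold for the pair while failing for either summand alone.
sum-mono₂ : (f g f′ g′ : Vector ℕ n) → (∀ i → f i + g i ≤ f′ i + g′ i) →
            sum f + sum g ≤ sum f′ + sum g′
sum-mono₂ f g f′ g′ le = begin
  sum f + sum g              ≡⟨ ∑-distrib-+ f g ⟨
  sum (λ i → f i + g i)      ≤⟨ sum-mono le ⟩
  sum (λ i → f′ i + g′ i)    ≡⟨ ∑-distrib-+ f′ g′ ⟩
  sum f′ + sum g′            ∎
  where open ≤-Reasoning

≤-sum : (f : Vector ℕ n) (i : Fin n) → f i ≤ sum f
≤-sum f zero    = m≤m+n _ _
≤-sum f (suc i) = m≤n⇒m≤o+n (f zero) (≤-sum (f ∘ suc) i)

sum-reverse : (f : Vector ℕ n) → sum (reverse f) ≡ sum f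
sum-reverse f = sym (sum-permute f Perm.reverse)

sum-tabulate : (g : ℕ → ℕ) (f : Vector ℕ n) →
               ListAction.sum (map g (toList f)) ≡ sum (g ∘ f)
sum-tabulate {zero}  g f = refl
sum-tabulate {suc n} g f = cong (g (f zero) +_) (sum-tabulate g (f ∘ suc))

Subset : ℕ → Set
Subset n = Fin n → Bool

restrict : Subset n → Vector ℕ n → Vector ℕ n
restrict K v i = if K i then v i else 0

infix 9 _[_]

_[_] : Vector ℕ n → Subset n → ℕ
v [ K ] = sum (restrict K v)

∣_∣ : Subset n → ℕ
∣ K ∣ = const 1 [ K ]

⁅_⁆ : Fin n → Subset n
⁅ m ⁆ i = does (i ≟ m)

insert : Fin n → Subset n → Subset n
insert m K i = ⁅ m ⁆ i ∨ K i

does-true : {P : Set} (P? : Dec P) → does P? ≡ true → P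
does-true (yes p) _ = p

does-false : {P : Set} (P? : Dec P) → does P? ≡ false → ¬ P
does-false (no ¬p) _ = ¬p

const-[] : (c : ℕ) (K : Subset n) → const c [ K ] ≡ c * ∣ K ∣
const-[] c K = begin
  const c [ K ]                           ≡⟨ sum-cong-≗ (λ i → scale (K i)) ⟩
  sum (λ i → c * restrict K (const 1) i)  ≡⟨ *-distribˡ-sum c (restrict K (const 1)) ⟨
  c * ∣ K ∣                               ∎
  where
  open ≡-Reasoning
  scale : ∀ b → (if b then c else 0) ≡ c * (if b then 1 else 0)
  scale true  = sym (*-identityʳ c)
  scale false = sym (*-zeroʳ c)

[]≤sum : (v : Vector ℕ n) (K : Subset n) → v [ K ] ≤ sum v
[]≤sum v K = sum-mono λ i → le (K i)
  where
  le : ∀ {x} b → (if b then x else 0) ≤ x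
  le true  = ≤-refl
  le false = z≤n

[]≤*∣∣ : {v : Vector ℕ n} {c : ℕ} (K : Subset n) → (∀ i → v i ≤ c) → v [ K ] ≤ c * ∣ K ∣
[]≤*∣∣ {v = v} {c} K v≤c = ≤-trans (sum-mono λ i → le (K i) (v≤c i)) (≤-reflexive (const-[] c K))
  where
  le : ∀ {x} b → x ≤ c → (if b then x else 0) ≤ (if b then c else 0)
  le true  x≤c = x≤c
  le false _   = z≤n

⁅⁆-[] : (v : Vector ℕ n) (m : Fin n) → v [ ⁅ m ⁆ ] ≡ v m
⁅⁆-[] {suc n} v zero = trans (cong (v zero +_) (sum-replicate-zero n)) (+-identityʳ _)
⁅⁆-[] v (suc m) = ⁅⁆-[] (v ∘ suc) m

insert-[] : (v : Vector ℕ n) (m : Fin n) (K : Subset n) → K m ≡ false →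
            v [ insert m K ] ≡ v m + v [ K ]
insert-[] v m K m∉K = begin
  v [ insert m K ]                                   ≡⟨ sum-cong-≗ split ⟩
  sum (λ i → restrict ⁅ m ⁆ v i + restrict K v i)    ≡⟨ ∑-distrib-+ (restrict ⁅ m ⁆ v) (restrict K v) ⟩
  v [ ⁅ m ⁆ ] + v [ K ]                              ≡⟨ cong (_+ v [ K ]) (⁅⁆-[] v m) ⟩
  v m + v [ K ]                                      ∎
  where
  open ≡-Reasoning
  split : ∀ i → restrict (insert m K) v i ≡ restrict ⁅ m ⁆ v i + restrict K v i
  split i with i ≟ m
  ... | no  _    = refl
  ... | yes refl rewrite m∉K = sym (+-identityʳ _)

-- Index sets carrying the largest entries.

maximum : (v : Vector ℕ n) →
          (∀ i → v i ≡ 0) ⊎ ∃ λ m → 0 < v m × (∀ i → v i ≤ v m)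
maximum {zero}  v = inj₁ λ ()
maximum {suc n} v with v zero in eq | maximum (v ∘ suc)
... | zero  | inj₁ zeros = inj₁ λ { zero → eq ; (suc i) → zeros i }
... | suc x | inj₁ zeros = inj₂ (zero , subst (0 <_) (sym eq) (s≤s z≤n) ,
  λ { zero → ≤-refl ; (suc i) → ≤-trans (≤-reflexive (zeros i)) z≤n })
... | x     | inj₂ (m , pos , top) with ≤-total x (v (suc m))
...   | inj₁ x≤ = inj₂ (suc m , pos , λ { zero → ≤-trans (≤-reflexive eq) x≤ ; (suc i) → top i })
...   | inj₂ ≤x = inj₂ (zero , ≤-trans pos ≤v₀ , λ { zero → ≤-refl ; (suc i) → ≤-trans (top i) ≤v₀ })
  where
  ≤v₀ : v (suc m) ≤ v zero
  ≤v₀ = ≤-trans ≤x (≤-reflexive (sym eq))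

positives : Vector ℕ n → Subset n
positives v i = does (0 <? v i)

-- A set of `a` indices of largest value, chosen to contain `m`. The field `positive` ensures that
-- lowering `v` by 1 on `M` is never truncated.
record Top (v : Vector ℕ n) (m : Fin n) (a : ℕ) (M : Subset n) : Set where
  field
    contains : M m ≡ true
    size     : ∣ M ∣ ≡ a
    positive : ∀ {i} → M i ≡ true → 0 < v i
    dominate : ∀ {i j} → M i ≡ true → M j ≡ false → v j ≤ v i

-- Greedy construction: starting from `⁅ m ⁆`, each stage adjoins an index of largest value outside
-- the current set. The bound by `∣ positives v ∣` keeps that value positive.
topSubset : (v : Vector ℕ n) (m : Fin n) → 0 < v m → (∀ i → v i ≤ v m) →
            ∀ a → suc a ≤ ∣ positives v ∣ → ∃ (Top v m (suc a))
topSubset v m 0<vm v≤vm zero _ = ⁅ m ⁆ , record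
  { contains = dec-true (m ≟ m) refl
  ; size     = ⁅⁆-[] (const 1) m
  ; positive = λ {i} i∈ → subst (λ k → 0 < v k) (sym (does-true (i ≟ m) i∈)) 0<vm
  ; dominate = λ {i} {j} i∈ _ → subst (λ k → v j ≤ v k) (sym (does-true (i ≟ m) i∈)) (v≤vm j)
  }
topSubset v m 0<vm v≤vm (suc a) a<p
  with topSubset v m 0<vm v≤vm a (≤-trans (n≤1+n _) a<p)
... | M , top = step (maximum outside)
  where
  open Top top
  -- Values on `M` are masked by 0, so that a positive maximum is attained outside `M`.
  outside : Vector ℕ _
  outside i = if M i then 0 else v i

  outside-∉ : ∀ {i} → M i ≡ false → outside i ≡ v i
  outside-∉ {i} i∉ rewrite i∉ = refl

  step : (∀ i → outside i ≡ 0) ⊎ (∃ λ m′ → 0 < outside m′ × (∀ i → outside i ≤ outside m′)) →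
         ∃ (Top v m (suc (suc a)))
  -- If nothing positive remains outside `M`, then `positives v` lies in `M`, which has only `suc a`
  -- elements.
  step (inj₁ zeros) = contradiction (≤-trans a<p (≤-trans (sum-mono le) (≤-reflexive size))) 1+n≰n
    where
    le : ∀ i → restrict (positives v) (const 1) i ≤ restrict M (const 1) i
    le i with positives v i in p | M i in q
    ... | false | _     = z≤n
    ... | true  | true  = ≤-refl
    ... | true  | false = contradiction (trans (sym (outside-∉ q)) (zeros i)) (>⇒≢ (does-true (0 <? v i) p))
  step (inj₂ (m′ , 0<out , out≤)) = insert m′ M , record
    { contains = contains′
    ; size     = trans (insert-[] (const 1) m′ M m′∉M) (cong suc size)
    ; positive = positive′
    ; dominate = dominate′
    }
    where
    m′∉M : M m′ ≡ false
    m′∉M = lemma (M m′) 0<out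
      where
      lemma : ∀ b → 0 < (if b then 0 else v m′) → b ≡ false
      lemma false _ = refl

    0<vm′ : 0 < v m′
    0<vm′ = subst (0 <_) (outside-∉ m′∉M) 0<out

    v≤vm′ : ∀ {j} → M j ≡ false → v j ≤ v m′
    v≤vm′ {j} j∉ = begin
      v j          ≡⟨ outside-∉ j∉ ⟨
      outside j    ≤⟨ out≤ j ⟩
      outside m′   ≡⟨ outside-∉ m′∉M ⟩
      v m′         ∎
      where open ≤-Reasoning

    contains′ : insert m′ M m ≡ true
    contains′ with m ≟ m′
    ... | yes _ = refl
    ... | no  _ = contains

    positive′ : ∀ {i} → insert m′ M i ≡ true → 0 < v i
    positive′ {i} i∈ with i ≟ m′
    ... | yes refl = 0<vm′
    ... | no  _    = positive i∈

    dominate′ : ∀ {i j} → insert m′ M i ≡ true → insert m′ M j ≡ false → v j ≤ v i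
    dominate′ {i} {j} i∈ j∉ with i ≟ m′ | j ≟ m′
    ... | yes refl | no _ = v≤vm′ j∉
    ... | no  _    | no _ = dominate i∈ j∉

-- The balance condition and threshold sets.

-- Subtracting `r [ L ]` on both sides leaves `∣ K ∣ * ∣ L ∣` plus the sum of `r` off `L` as a bound
-- for `r [ K ]`: the cut condition for a bipartite graph with degrees `r` on both sides.
Balanced : Vector ℕ n → Set
Balanced r = ∀ K L → r [ K ] + r [ L ] ≤ ∣ K ∣ * ∣ L ∣ + sum r

-- {i | v i > k}, with or without some of the indices having v i = k, maximizes
-- v(L) - k|L|.
threshold-optimal : (v : Vector ℕ n) (k : ℕ) (T : Subset n) →
  (∀ {i} → T i ≡ true → k ≤ v i) → (∀ {i} → T i ≡ false → v i ≤ k) →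
  ∀ L → v [ L ] + k * ∣ T ∣ ≤ v [ T ] + k * ∣ L ∣
threshold-optimal v k T above below L = begin
  v [ L ] + k * ∣ T ∣      ≡⟨ cong (v [ L ] +_) (const-[] k T) ⟨
  v [ L ] + const k [ T ]  ≤⟨ sum-mono₂ (restrict L v) (restrict T (const k)) (restrict T v) (restrict L (const k)) le ⟩
  v [ T ] + const k [ L ]  ≡⟨ cong (v [ T ] +_) (const-[] k L) ⟩
  v [ T ] + k * ∣ L ∣      ∎
  where
  open ≤-Reasoning
  le : ∀ i → restrict L v i + restrict T (const k) i ≤ restrict T v i + restrict L (const k) i
  le i with L i | T i in t
  ... | true  | true  = ≤-refl
  ... | true  | false = ≤-trans (≤-reflexive (+-identityʳ _)) (below t)
  ... | false | true  = ≤-trans (above t) (≤-reflexive (sym (+-identityʳ _)))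
  ... | false | false = ≤-refl

-- One Havel-Hakimi step preserves balance.

module HavelHakimi (r : Vector ℕ n) (m : Fin n) (r≤rm : ∀ i → r i ≤ r m)
                   (M : Subset n) (top : Top r m (r m) M) where
  open Top top

  -- The discarded index `m` stays in place with value 0, so `n` and the type of index sets are the
  -- same throughout the recursion.
  residual : Vector ℕ n
  residual i = if ⁅ m ⁆ i then 0 else r i ∸ (if M i then 1 else 0)

  residual-m : residual m ≡ 0
  residual-m rewrite dec-true (m ≟ m) refl = refl

  residual-∈ : ∀ {i} → i ≢ m → M i ≡ true → residual i + 1 ≡ r i
  residual-∈ {i} i≢m i∈ rewrite dec-false (i ≟ m) i≢m | i∈ = m∸n+n≡m (positive i∈)

  residual-∉ : ∀ {i} → i ≢ m → M i ≡ false → residual i ≡ r i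
  residual-∉ {i} i≢m i∉ rewrite dec-false (i ≟ m) i≢m | i∉ = refl

  residual-+ : ∀ {i} → i ≢ m → residual i + restrict M (const 1) i ≡ r i
  residual-+ {i} i≢m = lemma (M i) refl
    where
    lemma : ∀ b → M i ≡ b → residual i + (if b then 1 else 0) ≡ r i
    lemma true  i∈ = residual-∈ i≢m i∈
    lemma false i∉ = trans (+-identityʳ _) (residual-∉ i≢m i∉)

  residual≤ : ∀ i → residual i ≤ r i
  residual≤ i with ⁅ m ⁆ i
  ... | true  = z≤n
  ... | false = m∸n≤m (r i) (if M i then 1 else 0)

  -- Besides the row sum `r m`, the step removes 1 at each element of `M` other than `m`, which
  -- makes `r m ∸ 1`. The 1 on the left accounts for the loop at `m`, counted in both.
  sum-residual : sum r + 1 ≡ sum residual + r m + r m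
  sum-residual = begin
    sum r + 1
      ≡⟨ cong (sum r +_) (⁅⁆-[] (const 1) m) ⟨
    sum r + ∣ ⁅ m ⁆ ∣
      ≡⟨ ∑-distrib-+ r (restrict ⁅ m ⁆ (const 1)) ⟨
    sum (λ i → r i + restrict ⁅ m ⁆ (const 1) i)
      ≡⟨ sum-cong-≗ pointwise ⟩
    sum (λ i → residual i + restrict M (const 1) i + restrict ⁅ m ⁆ r i)
      ≡⟨ ∑-distrib-+ (λ i → residual i + restrict M (const 1) i) (restrict ⁅ m ⁆ r) ⟩
    sum (λ i → residual i + restrict M (const 1) i) + r [ ⁅ m ⁆ ]
      ≡⟨ cong₂ _+_ (∑-distrib-+ residual (restrict M (const 1))) (⁅⁆-[] r m) ⟩
    sum residual + ∣ M ∣ + r m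
      ≡⟨ cong (λ x → sum residual + x + r m) size ⟩
    sum residual + r m + r m ∎
    where
    open ≡-Reasoning
    pointwise : ∀ i → r i + restrict ⁅ m ⁆ (const 1) i
                    ≡ residual i + restrict M (const 1) i + restrict ⁅ m ⁆ r i
    pointwise i = lemma (i ≟ m)
      where
      lemma : (d : Dec (i ≡ m)) → r i + (if does d then 1 else 0)
              ≡ residual i + restrict M (const 1) i + (if does d then r i else 0)
      lemma (no i≢m)   = cong (_+ 0) (sym (residual-+ i≢m))
      lemma (yes refl) rewrite residual-m | contains = +-comm (r m) 1

  -- Cut by `r` and not by `residual`: the two differ by at most 1 away from `m`, so the weak
  -- inequalities of `threshold-optimal` still hold, while `dominate` makes such a set comparable
  -- with `M` apart from `m`.
  threshold : ℕ → Subset n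
  threshold k i = does (¬? (i ≟ m) ×-dec (k <? r i))

  threshold-∈ : ∀ {k i} → threshold k i ≡ true → i ≢ m × k < r i
  threshold-∈ {k} {i} = does-true (¬? (i ≟ m) ×-dec (k <? r i))

  threshold-∉ : ∀ {k i} → threshold k i ≡ false → i ≢ m → r i ≤ k
  threshold-∉ {k} {i} i∉ i≢m =
    ≮⇒≥ λ k<r → does-false (¬? (i ≟ m) ×-dec (k <? r i)) i∉ (i≢m , k<r)

  threshold-above : ∀ {k i} → threshold k i ≡ true → k ≤ residual i
  threshold-above {k} {i} i∈ with threshold-∈ i∈
  ... | i≢m , k<r = +-cancelʳ-≤ 1 k (residual i) (begin
    k + 1                                ≡⟨ +-comm k 1 ⟩
    suc k                                ≤⟨ k<r ⟩
    r i                                  ≡⟨ residual-+ i≢m ⟨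
    residual i + restrict M (const 1) i  ≤⟨ +-monoʳ-≤ (residual i) (χ≤1 (M i)) ⟩
    residual i + 1                       ∎)
    where
    open ≤-Reasoning
    χ≤1 : ∀ b → (if b then 1 else 0) ≤ 1
    χ≤1 true  = ≤-refl
    χ≤1 false = z≤n

  threshold-below : ∀ {k i} → threshold k i ≡ false → residual i ≤ k
  threshold-below {k} {i} i∉ = lemma (i ≟ m)
    where
    lemma : Dec (i ≡ m) → residual i ≤ k
    lemma (yes refl) = ≤-trans (≤-reflexive residual-m) z≤n
    lemma (no i≢m)   = ≤-trans (residual≤ i) (threshold-∉ i∉ i≢m)

  m∉threshold : ∀ k → threshold k m ≡ false
  m∉threshold k = dec-false (¬? (m ≟ m) ×-dec (k <? r m)) λ (m≢m , _) → m≢m refl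

  -- By `dominate`, an element `i` outside `M` brings all of `M` except `m` into the threshold set.
  -- These `r m ∸ 1` indices together with `i` make `r m`.
  threshold-large : ∀ {k i} → threshold k i ≡ true → M i ≡ false → r m ≤ ∣ threshold k ∣
  threshold-large {k} {i} i∈ i∉M = +-cancelʳ-≤ 1 (r m) ∣ threshold k ∣ (begin
    r m + 1                    ≡⟨ cong₂ _+_ size (⁅⁆-[] (const 1) i) ⟨
    ∣ M ∣ + ∣ ⁅ i ⁆ ∣          ≤⟨ sum-mono₂ (restrict M (const 1)) (restrict ⁅ i ⁆ (const 1))
                                    (restrict (threshold k) (const 1)) (restrict ⁅ m ⁆ (const 1)) le ⟩
    ∣ threshold k ∣ + ∣ ⁅ m ⁆ ∣  ≡⟨ cong (∣ threshold k ∣ +_) (⁅⁆-[] (const 1) m) ⟩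
    ∣ threshold k ∣ + 1        ∎)
    where
    open ≤-Reasoning
    M⊆ : ∀ {j} → M j ≡ true → j ≢ m → threshold k j ≡ true
    M⊆ {j} j∈ j≢m = dec-true (¬? (j ≟ m) ×-dec (k <? r j))
      (j≢m , <-≤-trans (proj₂ (threshold-∈ i∈)) (dominate j∈ i∉M))

    le : ∀ j → restrict M (const 1) j + restrict ⁅ i ⁆ (const 1) j
             ≤ restrict (threshold k) (const 1) j + restrict ⁅ m ⁆ (const 1) j
    le j = lemma (M j) refl (j ≟ i) (j ≟ m)
      where
      lemma : ∀ b → M j ≡ b → (d : Dec (j ≡ i)) (e : Dec (j ≡ m)) →
              (if b then 1 else 0) + (if does d then 1 else 0)
              ≤ restrict (threshold k) (const 1) j + (if does e then 1 else 0)
      lemma true  j∈ (yes refl) _          = contradiction (trans (sym j∈) i∉M) λ ()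
      lemma true  j∈ (no _)     (yes _)    = m≤n+m 1 _
      lemma true  j∈ (no _)     (no j≢m)   rewrite M⊆ j∈ j≢m = ≤-refl
      lemma false _  (yes refl) _          rewrite i∈ = s≤s z≤n
      lemma false _  (no _)     _          = z≤n

  -- Every residual entry is at most `r m`, hence at most `∣ L ∣`, so the product alone pays for `K`
  -- and the total pays for `L`.
  large-bound : ∀ K L → r m ≤ ∣ L ∣ →
                residual [ K ] + residual [ L ] ≤ ∣ K ∣ * ∣ L ∣ + sum residual
  large-bound K L rm≤l = +-mono-≤ (begin
    residual [ K ]  ≤⟨ []≤*∣∣ K (λ i → ≤-trans (residual≤ i) (r≤rm i)) ⟩
    r m * ∣ K ∣     ≤⟨ *-monoˡ-≤ ∣ K ∣ rm≤l ⟩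
    ∣ L ∣ * ∣ K ∣   ≡⟨ *-comm ∣ L ∣ ∣ K ∣ ⟩
    ∣ K ∣ * ∣ L ∣   ∎) ([]≤sum residual L)
    where open ≤-Reasoning

  insert-m : (K : Subset n) → K m ≡ false → (∀ {i} → K i ≡ true → M i ≡ true) →
             r [ insert m K ] ≡ r m + (residual [ K ] + ∣ K ∣)
  insert-m K m∉K K⊆M = begin
    r [ insert m K ]  ≡⟨ insert-[] r m K m∉K ⟩
    r m + r [ K ]     ≡⟨ cong (r m +_) (sum-cong-≗ pointwise) ⟩
    r m + sum (λ i → restrict K residual i + restrict K (const 1) i)
                      ≡⟨ cong (r m +_) (∑-distrib-+ (restrict K residual) (restrict K (const 1))) ⟩
    r m + (residual [ K ] + ∣ K ∣) ∎
    where
    open ≡-Reasoning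
    pointwise : ∀ i → restrict K r i ≡ restrict K residual i + restrict K (const 1) i
    pointwise i = lemma (K i) refl
      where
      lemma : ∀ b → K i ≡ b → (if b then r i else 0) ≡ (if b then residual i else 0) + (if b then 1 else 0)
      lemma false _  = refl
      lemma true  i∈ = sym (residual-∈ (λ { refl → contradiction (trans (sym i∈) m∉K) λ () }) (K⊆M i∈))

  -- This is the balance of `r` at the two sets enlarged by `m`: inside `M`, both sides exceed their
  -- residual counterparts by exactly `r m + r m + ∣ K ∣ + ∣ L ∣`.
  small-bound : Balanced r → ∀ K L → K m ≡ false → L m ≡ false →
                (∀ {i} → K i ≡ true → M i ≡ true) → (∀ {i} → L i ≡ true → M i ≡ true) →
                residual [ K ] + residual [ L ] ≤ ∣ K ∣ * ∣ L ∣ + sum residual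
  small-bound bal K L m∉K m∉L K⊆M L⊆M = +-cancelʳ-≤ (x + x + k + l) (a + b) (k * l + sum residual) (begin
    a + b + (x + x + k + l)                ≡⟨ regroup a b x k l ⟩
    (x + (a + k)) + (x + (b + l))          ≡⟨ cong₂ _+_ (insert-m K m∉K K⊆M) (insert-m L m∉L L⊆M) ⟨
    r [ insert m K ] + r [ insert m L ]    ≤⟨ bal (insert m K) (insert m L) ⟩
    ∣ insert m K ∣ * ∣ insert m L ∣ + sum r
      ≡⟨ cong (_+ sum r) (cong₂ _*_ (insert-[] (const 1) m K m∉K) (insert-[] (const 1) m L m∉L)) ⟩
    suc k * suc l + sum r                  ≡⟨ expand k l (sum r) ⟩
    k * l + k + l + (sum r + 1)            ≡⟨ cong (k * l + k + l +_) sum-residual ⟩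
    k * l + k + l + (sum residual + x + x) ≡⟨ collect k l (sum residual) x ⟩
    k * l + sum residual + (x + x + k + l) ∎)
    where
    open ≤-Reasoning
    a b x k l : ℕ
    a = residual [ K ]
    b = residual [ L ]
    x = r m
    k = ∣ K ∣
    l = ∣ L ∣
    regroup : ∀ a b x k l → a + b + (x + x + k + l) ≡ (x + (a + k)) + (x + (b + l))
    regroup = solve-∀
    expand : ∀ k l s → suc k * suc l + s ≡ k * l + k + l + (s + 1)
    expand = solve-∀
    collect : ∀ k l s x → k * l + k + l + (s + x + x) ≡ k * l + s + (x + x + k + l)
    collect = solve-∀

  inside? : ∀ k → (∃ λ i → threshold k i ≡ true × M i ≡ false)
                ⊎ (∀ {i} → threshold k i ≡ true → M i ≡ true)
  inside? k with any? (λ i → (threshold k i ≟ᵇ true) ×-dec (M i ≟ᵇ false))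
  ... | yes out  = inj₁ out
  ... | no  ¬out = inj₂ λ {i} i∈ → ¬-not λ i∉ → ¬out (i , i∈ , i∉)

  threshold-bound : Balanced r → ∀ s t →
    residual [ threshold s ] + residual [ threshold t ]
    ≤ ∣ threshold s ∣ * ∣ threshold t ∣ + sum residual
  threshold-bound bal s t with inside? t | inside? s
  ... | inj₁ (i , i∈ , i∉) | _ = large-bound (threshold s) (threshold t) (threshold-large i∈ i∉)
  ... | inj₂ _    | inj₁ (i , i∈ , i∉) = begin
    residual [ K ] + residual [ L ]    ≡⟨ +-comm (residual [ K ]) (residual [ L ]) ⟩
    residual [ L ] + residual [ K ]    ≤⟨ large-bound L K (threshold-large i∈ i∉) ⟩
    ∣ L ∣ * ∣ K ∣ + sum residual       ≡⟨ cong (_+ sum residual) (*-comm ∣ L ∣ ∣ K ∣) ⟩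
    ∣ K ∣ * ∣ L ∣ + sum residual       ∎
    where
    open ≤-Reasoning
    K L : Subset n
    K = threshold s
    L = threshold t
  ... | inj₂ t⊆M | inj₂ s⊆M =
    small-bound bal (threshold s) (threshold t) (m∉threshold s) (m∉threshold t) s⊆M t⊆M

  -- Reduction to threshold sets in two moves. For fixed `L` the worst `K` is the threshold set of
  -- level `∣ L ∣`; with that set in place of `K`, the worst `L` is the threshold set whose level is
  -- the new size `k′`.
  residual-balanced : Balanced r → Balanced residual
  residual-balanced bal K L = +-cancelʳ-≤ (l * k′ + k′ * l′) (a + b) (k * l + σ) (begin
    a + b + (l * k′ + k′ * l′)          ≡⟨ regroup₁ a b (l * k′) (k′ * l′) ⟩
    (a + l * k′) + (b + k′ * l′)        ≤⟨ +-mono-≤ (optimal l K) (optimal k′ L) ⟩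
    (a′ + l * k) + (b′ + k′ * l)        ≡⟨ regroup₂ a′ b′ (l * k) (k′ * l) ⟩
    (a′ + b′) + (l * k + k′ * l)        ≤⟨ +-monoˡ-≤ (l * k + k′ * l) (threshold-bound bal l k′) ⟩
    (k′ * l′ + σ) + (l * k + k′ * l)    ≡⟨ regroup₃ k l k′ l′ σ ⟩
    k * l + σ + (l * k′ + k′ * l′)      ∎)
    where
    open ≤-Reasoning
    k l k′ l′ a b a′ b′ σ : ℕ
    k  = ∣ K ∣
    l  = ∣ L ∣
    k′ = ∣ threshold l ∣
    l′ = ∣ threshold k′ ∣
    a  = residual [ K ]
    b  = residual [ L ]
    a′ = residual [ threshold l ]
    b′ = residual [ threshold k′ ]
    σ  = sum residual
    optimal : ∀ t J → residual [ J ] + t * ∣ threshold t ∣ ≤ residual [ threshold t ] + t * ∣ J ∣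
    optimal t = threshold-optimal residual t (threshold t) threshold-above threshold-below
    regroup₁ : ∀ a b c d → a + b + (c + d) ≡ (a + c) + (b + d)
    regroup₁ = solve-∀
    regroup₂ : ∀ a b c d → (a + c) + (b + d) ≡ (a + b) + (c + d)
    regroup₂ = solve-∀
    regroup₃ : ∀ k l k′ l′ σ → (k′ * l′ + σ) + (l * k + k′ * l) ≡ k * l + σ + (l * k′ + k′ * l′)
    regroup₃ = solve-∀

-- Symmetric matrices with prescribed row sums.

zeroOne-≤1 : ∀ {x} → x ≡ 0 ⊎ x ≡ 1 → x ≤ 1
zeroOne-≤1 (inj₁ refl) = z≤n
zeroOne-≤1 (inj₂ refl) = ≤-refl

record Realisation (r : Vector ℕ n) : Set where
  field
    matrix    : Matrix n
    zeroOne   : ∀ i j → matrix i j ≡ 0 ⊎ matrix i j ≡ 1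
    symmetric : ∀ i j → matrix i j ≡ matrix j i
    rowSum    : ∀ i → sum (matrix i) ≡ r i

module Extension (r : Vector ℕ n) (m : Fin n) (r≤rm : ∀ i → r i ≤ r m)
                 (M : Subset n) (top : Top r m (r m) M)
                 (B : Realisation (HavelHakimi.residual r m r≤rm M top)) where
  open HavelHakimi r m r≤rm M top
  open Top top
  open Realisation B

  -- Row and column `m` of the new matrix. The diagonal entry comes from the first branch only, so
  -- the loop at `m` counts once.
  cross : Fin n → Fin n → ℕ
  cross i j = if ⁅ m ⁆ i then (if M j then 1 else 0) else restrict ⁅ m ⁆ (const (if M i then 1 else 0)) j

  -- The residual 0 at `m` empties this row, and by symmetry the column, so adding `cross` never
  -- pushes an entry above 1.
  row-m : ∀ j → matrix m j ≡ 0
  row-m j = n≤0⇒n≡0 (≤-trans (≤-sum (matrix m) j) (≤-reflexive (trans (rowSum m) residual-m)))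

  bit : ∀ b → (if b then 1 else 0) ≡ 0 ⊎ (if b then 1 else 0) ≡ 1
  bit true  = inj₂ refl
  bit false = inj₁ refl

  extended-zeroOne : ∀ i j → matrix i j + cross i j ≡ 0 ⊎ matrix i j + cross i j ≡ 1
  extended-zeroOne i j with i ≟ m | j ≟ m
  ... | yes refl | _        rewrite row-m j = bit (M j)
  ... | no _     | yes refl rewrite symmetric i m | row-m i = bit (M i)
  ... | no _     | no _     rewrite +-identityʳ (matrix i j) = zeroOne i j

  cross-symmetric : ∀ i j → cross i j ≡ cross j i
  cross-symmetric i j with i ≟ m | j ≟ m
  ... | yes refl | yes refl = refl
  ... | yes _    | no _     = refl
  ... | no _     | yes _    = refl
  ... | no _     | no _     = refl

  cross-rowSum : ∀ i → residual i + sum (cross i) ≡ r i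
  cross-rowSum i with i ≟ m
  ... | yes refl = size
  ... | no i≢m   = trans (cong (_ +_) (⁅⁆-[] (const (if M i then 1 else 0)) m)) (m∸n+n≡m (≤r (M i) refl))
    where
    ≤r : ∀ b → M i ≡ b → (if b then 1 else 0) ≤ r i
    ≤r true  i∈ = positive i∈
    ≤r false _  = z≤n

  extended : Realisation r
  extended = record
    { matrix    = λ i j → matrix i j + cross i j
    ; zeroOne   = extended-zeroOne
    ; symmetric = λ i j → cong₂ _+_ (symmetric i j) (cross-symmetric i j)
    ; rowSum    = λ i → begin
        sum (λ j → matrix i j + cross i j)   ≡⟨ ∑-distrib-+ (matrix i) (cross i) ⟩
        sum (matrix i) + sum (cross i)       ≡⟨ cong (_+ sum (cross i)) (rowSum i) ⟩
        residual i + sum (cross i)           ≡⟨ cross-rowSum i ⟩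
        r i                                  ∎
    }
    where open ≡-Reasoning

-- Balance at `⁅ m ⁆` and `positives r`, where the latter already carries all of `sum r`. This gives
-- `topSubset` room for `r m` neighbours.
balanced⇒≤positives : (r : Vector ℕ n) → Balanced r → ∀ m → r m ≤ ∣ positives r ∣
balanced⇒≤positives r bal m = +-cancelʳ-≤ (sum r) (r m) ∣ P ∣ (begin
  r m + sum r                  ≤⟨ +-monoʳ-≤ (r m) (sum-mono all) ⟩
  r m + r [ P ]                ≡⟨ cong (_+ r [ P ]) (⁅⁆-[] r m) ⟨
  r [ ⁅ m ⁆ ] + r [ P ]        ≤⟨ bal ⁅ m ⁆ P ⟩
  ∣ ⁅ m ⁆ ∣ * ∣ P ∣ + sum r    ≡⟨ cong (λ x → x * ∣ P ∣ + sum r) (⁅⁆-[] (const 1) m) ⟩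
  1 * ∣ P ∣ + sum r            ≡⟨ cong (_+ sum r) (*-identityˡ ∣ P ∣) ⟩
  ∣ P ∣ + sum r                ∎)
  where
  open ≤-Reasoning
  P : Subset _
  P = positives r
  all : ∀ i → r i ≤ restrict P r i
  all i with r i
  ... | zero  = z≤n
  ... | suc _ = ≤-refl

-- Induction on a bound for `sum r`: a step at a positive maximum lowers the sum by `r m + r m ∸ 1`,
-- which is at least 1.
balanced⇒realisation : ∀ fuel (r : Vector ℕ n) → sum r ≤ fuel → Balanced r → Realisation r
balanced⇒realisation {n} fuel r σ≤ bal with maximum r
... | inj₁ zeros = record
  { matrix    = λ _ _ → 0
  ; zeroOne   = λ _ _ → inj₁ refl
  ; symmetric = λ _ _ → refl
  ; rowSum    = λ i → trans (sum-replicate-zero n) (sym (zeros i))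
  }
balanced⇒realisation zero r σ≤ bal | inj₂ (m , 0<rm , _) =
  contradiction (≤-trans (≤-trans 0<rm (≤-sum r m)) σ≤) λ ()
balanced⇒realisation {n} (suc fuel) r σ≤ bal | inj₂ (m , 0<rm , r≤rm) = step (neighbours (r m) 0<rm ≤-refl)
  where
  -- Generalising `r m` to `a` allows matching on `suc`, the form in which `topSubset` takes the
  -- size.
  neighbours : ∀ a → 0 < a → a ≤ r m → ∃ (Top r m a)
  neighbours (suc a) _ a≤ = topSubset r m 0<rm r≤rm a (≤-trans a≤ (balanced⇒≤positives r bal m))

  step : ∃ (Top r m (r m)) → Realisation r
  step (M , top) = Extension.extended r m r≤rm M top
    (balanced⇒realisation fuel residual σ′≤ (residual-balanced bal))
    where
    open HavelHakimi r m r≤rm M top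
    open ≤-Reasoning
    σ′≤ : sum residual ≤ fuel
    σ′≤ = +-cancelʳ-≤ 2 (sum residual) fuel (begin
      sum residual + 2               ≤⟨ +-monoʳ-≤ (sum residual) (+-mono-≤ 0<rm 0<rm) ⟩
      sum residual + (r m + r m)     ≡⟨ +-assoc (sum residual) (r m) (r m) ⟨
      sum residual + r m + r m       ≡⟨ sum-residual ⟨
      sum r + 1                      ≤⟨ +-monoˡ-≤ 1 σ≤ ⟩
      suc fuel + 1                   ≡⟨ +-suc fuel 1 ⟨
      fuel + 2                       ∎)

-- Majorization by the conjugate, in terms of subsets.

-- The right side is the sum of the first `∣ L ∣` components of the conjugate of `r`, so these are
-- the prefix inequalities of majorization with arbitrary sets in place of sorted prefixes.
Dominated : Vector ℕ n → Set
Dominated r = ∀ L → r [ L ] ≤ sum (λ i → r i ⊓ ∣ L ∣)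

-- After dominance is applied to `L`, the term `r i ⊓ ∣ L ∣` is bounded by `∣ L ∣` for `i` in `K`
-- and by `r i` elsewhere.
dominated⇒balanced : (r : Vector ℕ n) → Dominated r → Balanced r
dominated⇒balanced r dom K L = begin
  r [ K ] + r [ L ]                           ≤⟨ +-monoʳ-≤ (r [ K ]) (dom L) ⟩
  r [ K ] + sum (λ i → r i ⊓ l)               ≤⟨ sum-mono₂ (restrict K r) (λ i → r i ⊓ l) (restrict K (const l)) r le ⟩
  const l [ K ] + sum r                       ≡⟨ cong (_+ sum r) (trans (const-[] l K) (*-comm l ∣ K ∣)) ⟩
  ∣ K ∣ * l + sum r                           ∎
  where
  open ≤-Reasoning
  l : ℕ
  l = ∣ L ∣
  le : ∀ i → restrict K r i + r i ⊓ l ≤ restrict K (const l) i + r i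
  le i with K i
  ... | true  = ≤-trans (+-monoʳ-≤ (r i) (m⊓n≤n (r i) l)) (≤-reflexive (+-comm (r i) l))
  ... | false = m⊓n≤m (r i) l

-- The easy half of Gale-Ryser: the ones in the columns of `L` are counted by rows, and row `i` has
-- at most `r i` and at most `∣ L ∣` of them.
columns-≤ : {A : Matrix n} {r s : Vector ℕ n} → (∀ i j → A i j ≤ 1) →
            (∀ i → sum (A i) ≡ r i) → (∀ j → sum (transpose A j) ≡ s j) →
            ∀ L → s [ L ] ≤ sum (λ i → r i ⊓ ∣ L ∣)
columns-≤ {n} {A} {r} {s} A≤1 rows cols L = begin
  s [ L ]                                       ≡⟨ sum-cong-≗ column ⟩
  sum (λ j → sum (λ i → restrict L (A i) j))    ≡⟨ ∑-comm (λ j i → restrict L (A i) j) ⟩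
  sum (λ i → A i [ L ])                         ≤⟨ sum-mono row ⟩
  sum (λ i → r i ⊓ ∣ L ∣)                       ∎
  where
  open ≤-Reasoning
  column : ∀ j → restrict L s j ≡ sum (λ i → restrict L (A i) j)
  column j with L j
  ... | true  = sym (cols j)
  ... | false = sym (sum-replicate-zero n)
  row : ∀ i → A i [ L ] ≤ r i ⊓ ∣ L ∣
  row i = ⊓-glb (≤-trans ([]≤sum (A i) L) (≤-reflexive (rows i)))
                (≤-trans ([]≤*∣∣ L (A≤1 i)) (≤-reflexive (*-identityˡ ∣ L ∣)))

-- Prefix sums of sorted lists as optimal choices of entries.

-- The base case allows any ℓ because `take ℓ` may run past the end of the list.
data Pick : ℕ → ℕ → List ℕ → Set where
  []   : ∀ {ℓ} → Pick ℓ 0 []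
  keep : ∀ {ℓ s x xs} → Pick ℓ s xs → Pick (suc ℓ) (x + s) (x ∷ xs)
  skip : ∀ {ℓ s x xs} → Pick ℓ s xs → Pick ℓ s (x ∷ xs)

-- Sums of at most `ℓ` chosen entries depend only on the multiset of entries, which lets them pass
-- between a list and its sorted form.
pick-↭ : ∀ {xs ys ℓ s} → xs ↭ ys → Pick ℓ s xs → Pick ℓ s ys
pick-↭ ↭.refl            p               = p
pick-↭ (↭.prep x xs↭)    (keep p)        = keep (pick-↭ xs↭ p)
pick-↭ (↭.prep x xs↭)    (skip p)        = skip (pick-↭ xs↭ p)
pick-↭ {ℓ = ℓ} (↭.swap {ys = ys} x y xs↭) (keep (keep {s = s} p)) =
  subst (λ t → Pick ℓ t (y ∷ x ∷ ys)) (x∙yz≈y∙xz y x s) (keep (keep (pick-↭ xs↭ p)))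
pick-↭ (↭.swap x y xs↭)  (keep (skip p)) = skip (keep (pick-↭ xs↭ p))
pick-↭ (↭.swap x y xs↭)  (skip (keep p)) = keep (skip (pick-↭ xs↭ p))
pick-↭ (↭.swap x y xs↭)  (skip (skip p)) = skip (skip (pick-↭ xs↭ p))
pick-↭ (↭.trans xs↭ ↭ys) p               = pick-↭ ↭ys (pick-↭ xs↭ p)

pick-take : ∀ ℓ xs → Pick ℓ (ListAction.sum (take ℓ xs)) xs
pick-take zero    []       = []
pick-take zero    (x ∷ xs) = skip (pick-take zero xs)
pick-take (suc ℓ) []       = []
pick-take (suc ℓ) (x ∷ xs) = keep (pick-take ℓ xs)

-- Each entry on the left is at most its predecessor in `x ∷ xs`, so shifting the window by one
-- place can only lose.
sum-take-suc : ∀ {x xs} → Linked _≥_ (x ∷ xs) → ∀ ℓ →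
               ListAction.sum (take (suc ℓ) xs) ≤ x + ListAction.sum (take ℓ xs)
sum-take-suc [-]          ℓ       = z≤n
sum-take-suc (x≥y ∷ _)    zero    = +-monoˡ-≤ 0 x≥y
sum-take-suc (x≥y ∷ xs↘) (suc ℓ)  = +-mono-≤ x≥y (sum-take-suc xs↘ ℓ)

-- The prefix is the best choice in a decreasing list: after a skip, `sum-take-suc` moves the bound
-- for the tail back by one place.
pick-≤ : ∀ {xs ℓ s} → Linked _≥_ xs → Pick ℓ s xs → s ≤ ListAction.sum (take ℓ xs)
pick-≤ xs↘ []                         = z≤n
pick-≤ xs↘ (keep {x = x} p)           = +-monoʳ-≤ x (pick-≤ (Linked.tail xs↘) p)
pick-≤ {ℓ = zero}  xs↘ (skip p)       = pick-≤ (Linked.tail xs↘) p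
pick-≤ {ℓ = suc ℓ} xs↘ (skip p)       = ≤-trans (pick-≤ (Linked.tail xs↘) p) (sum-take-suc xs↘ ℓ)

pick-≤-sort↓ : ∀ {xs ℓ s} → Pick ℓ s xs → s ≤ ListAction.sum (take ℓ (sort↓ xs))
pick-≤-sort↓ {xs} p = pick-≤ (Sort.sort-↗ ≥-decTotalOrder xs) (pick-↭ (↭-sym (Sort.sort-↭ ≥-decTotalOrder xs)) p)

pick-sort↓ : ∀ ℓ xs → Pick ℓ (ListAction.sum (take ℓ (sort↓ xs))) xs
pick-sort↓ ℓ xs = pick-↭ (Sort.sort-↭ ≥-decTotalOrder xs) (pick-take ℓ (sort↓ xs))

-- Both sides are the largest sum of at most `ℓ` entries.
sum-take-sort↓ : ∀ {xs} → Linked _≥_ xs → ∀ ℓ →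
                 ListAction.sum (take ℓ (sort↓ xs)) ≡ ListAction.sum (take ℓ xs)
sum-take-sort↓ {xs} xs↘ ℓ = ≤-antisym (pick-≤ xs↘ (pick-sort↓ ℓ xs)) (pick-≤-sort↓ (pick-take ℓ xs))

pick⇒subset : ∀ {ℓ s} (v : Vector ℕ n) → Pick ℓ s (toList v) → ∃ λ L → ∣ L ∣ ≤ ℓ × v [ L ] ≡ s
pick⇒subset {zero}  v []       = (λ ()) , z≤n , refl
pick⇒subset {suc n} v (keep p) with pick⇒subset (v ∘ suc) p
... | L , size , sum≡ = (λ { zero → true ; (suc i) → L i }) , s≤s size , cong (v zero +_) sum≡
pick⇒subset {suc n} v (skip p) with pick⇒subset (v ∘ suc) p
... | L , size , sum≡ = (λ { zero → false ; (suc i) → L i }) , size , sum≡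

subset⇒pick : (v : Vector ℕ n) (L : Subset n) → Pick ∣ L ∣ (v [ L ]) (toList v)
subset⇒pick {zero}  v L = []
subset⇒pick {suc n} v L with L zero
... | true  = keep (subset⇒pick (v ∘ suc) (L ∘ suc))
... | false = skip (subset⇒pick (v ∘ suc) (L ∘ suc))

-- Prefix sums of the conjugate partition.

count> : ℕ → List ℕ → ℕ
count> k xs = length (filter (suc k ≤?_) xs)

count>-∷ : ∀ k x xs → count> k (x ∷ xs) ≡ (if does (suc k ≤? x) then 1 else 0) + count> k xs
count>-∷ k x xs with does (suc k ≤? x)
... | true  = refl
... | false = refl

count>-anti : ∀ xs k → count> (suc k) xs ≤ count> k xs
count>-anti []       k = z≤n
count>-anti (x ∷ xs) k rewrite count>-∷ (suc k) x xs | count>-∷ k x xs =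
  +-mono-≤ (le (suc (suc k) ≤? x) (suc k ≤? x)) (count>-anti xs k)
  where
  le : (d : Dec (suc (suc k) ≤ x)) (e : Dec (suc k ≤ x)) →
       (if does d then 1 else 0) ≤ (if does e then 1 else 0)
  le (yes _) (yes _) = ≤-refl
  le (yes p) (no ¬p) = contradiction (<⇒≤ p) ¬p
  le (no _)  _       = z≤n

sum-applyUpTo-+ : ∀ (f g : ℕ → ℕ) j → ListAction.sum (applyUpTo (λ k → f k + g k) j)
                ≡ ListAction.sum (applyUpTo f j) + ListAction.sum (applyUpTo g j)
sum-applyUpTo-+ f g zero    = refl
sum-applyUpTo-+ f g (suc j) =
  trans (cong (f 0 + g 0 +_) (sum-applyUpTo-+ (f ∘ suc) (g ∘ suc) j)) (interchange (f 0) (g 0) _ _)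

sum-applyUpTo-cong : ∀ {f g : ℕ → ℕ} → f ≗ g → ∀ j →
                     ListAction.sum (applyUpTo f j) ≡ ListAction.sum (applyUpTo g j)
sum-applyUpTo-cong f≗g zero    = refl
sum-applyUpTo-cong f≗g (suc j) = cong₂ _+_ (f≗g 0) (sum-applyUpTo-cong (f≗g ∘ suc) j)

sum-applyUpTo-zero : ∀ j → ListAction.sum (applyUpTo (const 0) j) ≡ 0
sum-applyUpTo-zero zero    = refl
sum-applyUpTo-zero (suc j) = sum-applyUpTo-zero j

sum-applyUpTo-< : ∀ x j → ListAction.sum (applyUpTo (λ k → if does (suc k ≤? x) then 1 else 0) j) ≡ x ⊓ j
sum-applyUpTo-< zero    j       = sum-applyUpTo-zero j
sum-applyUpTo-< (suc x) zero    = refl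
sum-applyUpTo-< (suc x) (suc j) = cong suc (sum-applyUpTo-< x j)

-- The cells in the first `j` columns of the Ferrers diagram, counted by columns and by rows.
sum-count> : ∀ xs j → ListAction.sum (applyUpTo (λ k → count> k xs) j) ≡ ListAction.sum (map (_⊓ j) xs)
sum-count> []       j = sum-applyUpTo-zero j
sum-count> (x ∷ xs) j = begin
  ListAction.sum (applyUpTo (λ k → count> k (x ∷ xs)) j)
    ≡⟨ sum-applyUpTo-cong (λ k → count>-∷ k x xs) j ⟩
  ListAction.sum (applyUpTo (λ k → [ k <x] + count> k xs) j)
    ≡⟨ sum-applyUpTo-+ [_<x] (λ k → count> k xs) j ⟩
  ListAction.sum (applyUpTo [_<x] j) + ListAction.sum (applyUpTo (λ k → count> k xs) j)
    ≡⟨ cong₂ _+_ (sum-applyUpTo-< x j) (sum-count> xs j) ⟩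
  x ⊓ j + ListAction.sum (map (_⊓ j) xs) ∎
  where
  open ≡-Reasoning
  [_<x] : ℕ → ℕ
  [ k <x] = if does (suc k ≤? x) then 1 else 0

take-applyUpTo : ∀ (f : ℕ → ℕ) ℓ m → take ℓ (applyUpTo f m) ≡ applyUpTo f (m ⊓ ℓ)
take-applyUpTo f zero    zero    = refl
take-applyUpTo f zero    (suc m) = refl
take-applyUpTo f (suc ℓ) zero    = refl
take-applyUpTo f (suc ℓ) (suc m) = cong (f 0 ∷_) (take-applyUpTo (f ∘ suc) ℓ m)

-- A prefix of the conjugate stops at the largest part `b`; this shows that stopping there loses
-- nothing.
map-⊓-bounded : ∀ {b xs} → All (_≤ b) xs → ∀ ℓ → map (_⊓ (b ⊓ ℓ)) xs ≡ map (_⊓ ℓ) xs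
map-⊓-bounded []                            ℓ = refl
map-⊓-bounded {b} (_∷_ {x = x} x≤b xs≤b) ℓ =
  cong₂ _∷_ (trans (sym (⊓-assoc x b ℓ)) (cong (_⊓ ℓ) (m≤n⇒m⊓n≡m x≤b))) (map-⊓-bounded xs≤b ℓ)

conjugate-applyUpTo : ∀ xs → conjugate xs ≡ applyUpTo (λ k → count> k xs) (max 0 xs)
conjugate-applyUpTo xs = map-upTo (λ k → count> k xs) (max 0 xs)

conjugate-↘ : ∀ xs → Linked _≥_ (conjugate xs)
conjugate-↘ xs = subst (Linked _≥_) (sym (conjugate-applyUpTo xs))
  (applyUpTo⁺₂ (λ k → count> k xs) (max 0 xs) (count>-anti xs))

sum-take-conjugate : ∀ ℓ xs → ListAction.sum (take ℓ (conjugate xs)) ≡ ListAction.sum (map (_⊓ ℓ) xs)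
sum-take-conjugate ℓ xs = begin
  ListAction.sum (take ℓ (conjugate xs))              ≡⟨ cong (ListAction.sum ∘ take ℓ) (conjugate-applyUpTo xs) ⟩
  ListAction.sum (take ℓ (applyUpTo c b))             ≡⟨ cong ListAction.sum (take-applyUpTo c ℓ b) ⟩
  ListAction.sum (applyUpTo c (b ⊓ ℓ))                ≡⟨ sum-count> xs (b ⊓ ℓ) ⟩
  ListAction.sum (map (_⊓ (b ⊓ ℓ)) xs)                ≡⟨ cong ListAction.sum (map-⊓-bounded (xs≤max 0 xs) ℓ) ⟩
  ListAction.sum (map (_⊓ ℓ) xs)                      ∎
  where
  open ≡-Reasoning
  b : ℕ
  b = max 0 xs
  c : ℕ → ℕ
  c k = count> k xs

sum-conjugate : ∀ xs → ListAction.sum (conjugate xs) ≡ ListAction.sum xs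
sum-conjugate xs = begin
  ListAction.sum (conjugate xs)              ≡⟨ cong ListAction.sum (conjugate-applyUpTo xs) ⟩
  ListAction.sum (applyUpTo c (max 0 xs))    ≡⟨ sum-count> xs (max 0 xs) ⟩
  ListAction.sum (map (_⊓ max 0 xs) xs)      ≡⟨ cong ListAction.sum (map-id-local (All.map m≤n⇒m⊓n≡m (xs≤max 0 xs))) ⟩
  ListAction.sum xs                          ∎
  where
  open ≡-Reasoning
  c : ℕ → ℕ
  c k = count> k xs

sum-take-sort↓-conjugate : ∀ ℓ (r : Vector ℕ n) →
  ListAction.sum (take ℓ (sort↓ (conjugate (toList r)))) ≡ sum (λ i → r i ⊓ ℓ)
sum-take-sort↓-conjugate ℓ r = begin
  ListAction.sum (take ℓ (sort↓ (conjugate (toList r))))  ≡⟨ sum-take-sort↓ (conjugate-↘ (toList r)) ℓ ⟩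
  ListAction.sum (take ℓ (conjugate (toList r)))          ≡⟨ sum-take-conjugate ℓ (toList r) ⟩
  ListAction.sum (map (_⊓ ℓ) (toList r))                  ≡⟨ sum-tabulate (_⊓ ℓ) r ⟩
  sum (λ i → r i ⊓ ℓ)                                     ∎
  where open ≡-Reasoning

sum-toList : (v : Vector ℕ n) → ListAction.sum (toList v) ≡ sum v
sum-toList v = trans (cong ListAction.sum (sym (map-id (toList v)))) (sum-tabulate (λ x → x) v)

≼-conjugate : (r v : Vector ℕ n) → sum v ≡ sum r → (∀ L → v [ L ] ≤ sum (λ i → r i ⊓ ∣ L ∣)) →
              toList v ≼ conjugate (toList r)
≼-conjugate r v sum≡ bound = prefix , (begin
  ListAction.sum (toList v)               ≡⟨ sum-toList v ⟩
  sum v                                   ≡⟨ sum≡ ⟩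
  sum r                                   ≡⟨ sum-toList r ⟨
  ListAction.sum (toList r)               ≡⟨ sum-conjugate (toList r) ⟨
  ListAction.sum (conjugate (toList r))   ∎)
  where
  open ≡-Reasoning
  prefix : ∀ ℓ → ListAction.sum (take ℓ (sort↓ (toList v))) ≤ ListAction.sum (take ℓ (sort↓ (conjugate (toList r))))
  prefix ℓ with pick⇒subset v (pick-sort↓ ℓ (toList v))
  -- The set attaining the prefix sum may have fewer than `ℓ` elements; monotonicity of `⊓` raises
  -- the bound to `ℓ`.
  ... | L , size , sum≡ = ≤-trans (≤-reflexive (sym sum≡)) (≤-trans (bound L)
    (≤-trans (sum-mono λ i → ⊓-monoʳ-≤ (r i) size) (≤-reflexive (sym (sum-take-sort↓-conjugate ℓ r)))))

-- Reversing `r` and `L` together changes neither the sum over the set nor its size, so bounds for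
-- `reverse r` transfer to `r`.
≼-conjugate⇒dominated : (r : Vector ℕ n) → toList (reverse r) ≼ conjugate (toList r) → Dominated r
≼-conjugate⇒dominated r (prefix , _) L = begin
  r [ L ]                                                   ≡⟨ sum-reverse (restrict L r) ⟨
  reverse r [ reverse L ]                                   ≤⟨ pick-≤-sort↓ (subset⇒pick (reverse r) (reverse L)) ⟩
  ListAction.sum (take ℓ (sort↓ (toList (reverse r))))      ≤⟨ prefix ℓ ⟩
  ListAction.sum (take ℓ (sort↓ (conjugate (toList r))))    ≡⟨ sum-take-sort↓-conjugate ℓ r ⟩
  sum (λ i → r i ⊓ ℓ)                                       ≡⟨ cong (λ k → sum (λ i → r i ⊓ k)) (sum-reverse (restrict L (const 1))) ⟩
  sum (λ i → r i ⊓ ∣ L ∣)                                   ∎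
  where
  open ≤-Reasoning
  ℓ : ℕ
  ℓ = ∣ reverse L ∣

-- Matrices invariant under the reflection.

theorem7 : (n : ℕ) → 1 ≤ n → (R S : Vector ℕ n) →
    (∀ i → R i ≤ n) → (∀ j → S j ≤ n) → sum R ≡ sum S →
    Satisfiable (𝒜⁺¹ R S) ⇔ (S ≗ reverse R × toList (reverse R) ≼ conjugate (toList R))
theorem7 n _ R S _ _ _ = mk⇔ necessary sufficient
  where
  open ≡-Reasoning

  necessary : Satisfiable (𝒜⁺¹ R S) → S ≗ reverse R × toList (reverse R) ≼ conjugate (toList R)
  necessary (A , A∈) = S≗ , ≼-conjugate R (reverse R) (sum-reverse R)
    (columns-≤ (λ i j → zeroOne-≤1 (entries i j)) rowSums λ j → trans (colSums j) (S≗ j))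
    where
    open 𝒜⁺¹ A∈
    S≗ : S ≗ reverse R
    S≗ j = begin
      S j                                       ≡⟨ colSums j ⟨
      -- By invariance, column `j` is row `opposite j` read backwards.
      sum (λ i → A i j)                         ≡⟨ sum-cong-≗ (λ i → invariant i j) ⟩
      sum (reverse (A (opposite j)))            ≡⟨ sum-reverse (A (opposite j)) ⟩
      sum (A (opposite j))                      ≡⟨ rowSums (opposite j) ⟩
      R (opposite j)                            ∎

  sufficient : S ≗ reverse R × toList (reverse R) ≼ conjugate (toList R) → Satisfiable (𝒜⁺¹ R S)
  sufficient (S≗ , R≼) = (λ i j → matrix i (opposite j)) , record
    { entries   = λ i j → zeroOne i (opposite j)
    ; rowSums   = λ i → trans (sum-reverse (matrix i)) (rowSum i)
    ; colSums   = λ j → begin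
        sum (λ i → matrix i (opposite j))   ≡⟨ sum-cong-≗ (λ i → symmetric i (opposite j)) ⟩
        sum (matrix (opposite j))           ≡⟨ rowSum (opposite j) ⟩
        R (opposite j)                      ≡⟨ S≗ j ⟨
        S j                                 ∎
    -- At the reflected position the reversal of columns meets `opposite i`, so the two reversals
    -- cancel and symmetry remains.
    ; invariant = λ i j → begin
        matrix i (opposite j)                         ≡⟨ symmetric i (opposite j) ⟩
        matrix (opposite j) i                         ≡⟨ cong (matrix (opposite j)) (opposite-involutive i) ⟨
        matrix (opposite j) (opposite (opposite i))   ∎
    }
    where
    open Realisation (balanced⇒realisation (sum R) R ≤-refl
                       (dominated⇒balanced R (≼-conjugate⇒dominated R R≼)))
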